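{- Let $S=\{s_1<\cdots<s_n\}$ be a non-empty set of positive integers, and let $\mathcal{B}_S$ be the collection of sets $\{a_1<\cdots<a_n\}$ of positive integers such that $a_1\le s_1,\ \ldots,\ a_n\le s_n$. Then $\mathcal{B}_S$ is the collection of bases of a matroid (on the ground set $[s_n]=\{1,\dots,s_n\}$).
   Context: The notation $\{a_1<\cdots<a_n\}$ means a set of $n$ distinct elements $a_1,\dots,a_n$ listed in increasing order. -}

module Defs where

open import Data.Fin.Base as Fin using (Fin)
open import Data.List.Base using (List)
import Data.List.Membership.Propositional as List
open import Data.Nat.Base using (ℕ; _≤_; _<_)
open import Data.Product.Base using (∃; _×_)
open import Data.Vec.Functional using (Vector)
open import Function.Bundles using (_⇔_)
open import Level using (0ℓ)
open import Relation.Binary.Definitions using (Monotonic₁; _Respects_)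
open import Relation.Binary.PropositionalEquality.Core using (_≡_)
open import Relation.Unary
  using (Pred; _∈_; _⊆_; _≐_; _∪_; _∖_; ｛_｝; Satisfiable)

Subset : Set → Set₁
Subset X = Pred X 0ℓ

Finite : {X : Set} → Subset X → Set
Finite {X} E = ∃ λ (xs : List X) → ∀ x → x ∈ E ⇔ x List.∈ xs

-- Sets are predicates up to extensional equality _≐_, so a collection of sets
-- is a predicate on predicates that respects _≐_.

record IsMatroidBases {X : Set} (E : Subset X)
                      (𝓑 : Pred (Subset X) 0ℓ) : Set₁ where
  field
    respects-≐ : 𝓑 Respects _≐_
    finite     : Finite E
    ground     : ∀ {A} → A ∈ 𝓑 → A ⊆ E
    nonempty   : Satisfiable 𝓑
    exchange   : ∀ {A B} → A ∈ 𝓑 → B ∈ 𝓑 → ∀ {x} → x ∈ A ∖ B →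
                 ∃ λ y → y ∈ B ∖ A × ((A ∖ ｛ x ｝) ∪ ｛ y ｝) ∈ 𝓑

[1⋯_] : ℕ → Subset ℕ
[1⋯ m ] x = 1 ≤ x × x ≤ m

-- A = {a₁ < ⋯ < aₙ} is a set of positive integers.  Indices are shifted:
-- aᵢ₊₁ is the value of a at the i-th element of Fin n, counted from 0.

record _Lists_ {n : ℕ} (a : Vector ℕ n) (A : Subset ℕ) : Set where
  field
    positive   : ∀ i → 1 ≤ a i
    increasing : Monotonic₁ Fin._<_ _<_ a
    elements   : ∀ x → x ∈ A ⇔ (∃ λ i → a i ≡ x)

-- The argument is the increasing listing s of S, which S determines uniquely.

𝓑 : {n : ℕ} → Vector ℕ n → Pred (Subset ℕ) 0ℓ
𝓑 {n} s A = ∃ λ (a : Vector ℕ n) → a Lists A × (∀ i → a i ≤ s i)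

-- A strictly increasing listing c satisfies c i ≤ t as soon as at least i + 1
-- elements of its range are ≤ t.  For the exchange of x = a k ∉ B, add the least
-- element y = b j of B ∖ A and list C = (A ∖ {x}) ∪ {y} as c.  Given i, if i < j
-- then b 0, …, b i belong to A and differ from x, so they are i + 1 elements of C
-- that are ≤ s i.  If j ≤ i then y ≤ b i ≤ s i, so a 0, …, a i with x replaced
-- by y will do.
module Submission where

open import Defs
open import Data.Fin.Base as Fin
  using (Fin; zero; suc; toℕ; fromℕ<; inject≤; punchIn; punchOut)
import Data.Fin.Properties as Fin
open import Data.List.Base using (applyUpTo)
open import Data.List.Membership.Propositional.Properties
  using (∈-applyUpTo⁺; ∈-applyUpTo⁻)
open import Data.Nat.Base as ℕ using (ℕ; suc; _≤_; _<_; z<s; s<s; s<s⁻¹; s≤s; z≤n)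
import Data.Nat.Properties as ℕ
open import Data.Product.Base using (∃; _×_; _,_; proj₁; proj₂)
open import Data.Sum.Base using (_⊎_; inj₁; inj₂; [_,_]′)
open import Data.Vec.Functional using (Vector; last; head; tail; updateAt)
  renaming (_∷_ to _◂_)
open import Data.Vec.Functional.Properties using (updateAt-updates; updateAt-minimal)
open import Function.Base using (_∘_; const)
open import Function.Bundles using (mk⇔; module Equivalence)
open import Function.Definitions using (Injective)
open import Relation.Binary.Definitions using (Monotonic₁; _Respects_; tri<; tri≈; tri>)
open import Relation.Binary.PropositionalEquality
  using (_≡_; _≢_; refl; sym; trans; cong; subst)
open import Relation.Nullary using (¬_; yes; no; contradiction)
open import Relation.Unary
  using (_∈_; _∉_; _⊆_; _≐_; _∪_; _∖_; ｛_｝)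

open Equivalence using (to; from)
open _Lists_

private
  variable
    n : ℕ
    a : Vector ℕ n

Range : Vector ℕ n → Subset ℕ
Range a x = ∃ λ i → a i ≡ x

Increasing : Vector ℕ n → Set
Increasing = Monotonic₁ Fin._<_ _<_

increasing⇒mono-≤ : Increasing a → Monotonic₁ Fin._≤_ _≤_ a
increasing⇒mono-≤ {a = a} a↑ {i} {j} i≤j with ℕ.m≤n⇒m<n∨m≡n i≤j
... | inj₁ i<j = ℕ.<⇒≤ (a↑ i<j)
... | inj₂ i≡j = ℕ.≤-reflexive (cong a (Fin.toℕ-injective i≡j))

increasing⇒cancel-< : Increasing a → ∀ {i j} → a i < a j → i Fin.< j
increasing⇒cancel-< a↑ {i} {j} ai<aj with i Fin.<? j
... | yes i<j = i<j
... | no  i≮j = contradiction (increasing⇒mono-≤ a↑ (ℕ.≮⇒≥ i≮j)) (ℕ.<⇒≱ ai<aj)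

increasing⇒injective : Increasing a → Injective _≡_ _≡_ a
increasing⇒injective a↑ {i} {j} ai≡aj with Fin.<-cmp i j
... | tri< i<j _ _ = contradiction ai≡aj (ℕ.<⇒≢ (a↑ i<j))
... | tri≈ _ i≡j _ = i≡j
... | tri> _ _ j<i = contradiction (sym ai≡aj) (ℕ.<⇒≢ (a↑ j<i))

◂-increasing : ∀ {x} → (∀ i → x < a i) → Increasing a → Increasing (x ◂ a)
◂-increasing x<a a↑ {zero}  {suc j} _   = x<a j
◂-increasing x<a a↑ {suc i} {suc j} i<j = a↑ (s<s⁻¹ i<j)

-- One step of insertion sort. The place where `y` lands is not recorded: bounds on the entries of
-- `c` are later read off `Range c` by counting.
insert-increasing : ∀ {n} {a : Vector ℕ n} {y} → Increasing a → y ∉ Range a →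
                    ∃ λ (c : Vector ℕ (suc n)) → Increasing c × Range c ≐ Range a ∪ ｛ y ｝
insert-increasing {n = ℕ.zero} {a = a} {y} _ _ =
  y ◂ a , ◂-increasing {a = a} (λ ()) (λ { {()} }) ,
  (λ { (zero , y≡x) → inj₂ y≡x }) , (λ { (inj₁ (() , _)) ; (inj₂ y≡x) → zero , y≡x })
insert-increasing {n = suc n} {a = a} {y} a↑ y∉a with ℕ.<-cmp y (head a)
... | tri≈ _ y≡a₀ _ = contradiction (zero , sym y≡a₀) y∉a
... | tri< y<a₀ _ _ =
  y ◂ a , ◂-increasing {a = a} (λ i → ℕ.<-≤-trans y<a₀ (increasing⇒mono-≤ a↑ z≤n)) a↑ ,
  (λ { (zero , y≡x) → inj₂ y≡x ; (suc i , ai≡x) → inj₁ (i , ai≡x) }) ,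
  (λ { (inj₁ (i , ai≡x)) → suc i , ai≡x ; (inj₂ y≡x) → zero , y≡x })
... | tri> _ _ a₀<y
  with c , c↑ , c⊆ , ⊆c ← insert-increasing {a = tail a} (λ i<j → a↑ (s<s i<j))
                                            (λ (i , ai≡y) → y∉a (suc i , ai≡y)) =
  -- `head a` may stay in front: each entry of `c` is either a later entry of `a` or `y`, and both
  -- exceed it.
  head a ◂ c , ◂-increasing {a = c} (λ i → a₀< (c⊆ (i , refl))) c↑ ,
  (λ { (zero , a₀≡x) → inj₁ (zero , a₀≡x) ; (suc i , ci≡x) → widen (c⊆ (i , ci≡x)) }) ,
  (λ { (inj₁ (zero , a₀≡x)) → zero , a₀≡x
     ; (inj₁ (suc i , ai≡x)) → shift (⊆c (inj₁ (i , ai≡x)))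
     ; (inj₂ y≡x) → shift (⊆c (inj₂ y≡x)) })
  where
  a₀< : ∀ {x} → x ∈ Range (tail a) ∪ ｛ y ｝ → head a < x
  a₀< (inj₁ (i , refl)) = a↑ z<s
  a₀< (inj₂ refl)       = a₀<y

  widen : Range (tail a) ∪ ｛ y ｝ ⊆ Range a ∪ ｛ y ｝
  widen (inj₁ (i , ai≡x)) = inj₁ (suc i , ai≡x)
  widen (inj₂ y≡x)        = inj₂ y≡x

  shift : Range c ⊆ Range (head a ◂ c)
  shift (i , ci≡x) = suc i , ci≡x

punchIn-mono-< : ∀ k {i j : Fin n} → i Fin.< j → punchIn k i Fin.< punchIn k j
punchIn-mono-< k {i} {j} i<j =
  ℕ.≰⇒> (ℕ.<⇒≱ i<j ∘ Fin.punchIn-cancel-≤ k j i)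

-- Skipping the index `k` removes the value `a k` for good because an injective listing has it at no
-- other index.
remove-range : {a : Vector ℕ (suc n)} → Injective _≡_ _≡_ a → ∀ k →
               Range (a ∘ punchIn k) ≐ Range a ∖ ｛ a k ｝
remove-range {a = a} a-inj k =
  (λ { (i , refl) → (punchIn k i , refl) , Fin.punchInᵢ≢i k i ∘ sym ∘ a-inj }) ,
  λ { ((i , refl) , ak≢ai) → let k≢i = ak≢ai ∘ cong a in
      punchOut k≢i , cong a (Fin.punchIn-punchOut k≢i) }

exchange-increasing : {a : Vector ℕ (suc n)} → Increasing a → ∀ k {y} → y ∉ Range a →
                      ∃ λ (c : Vector ℕ (suc n)) →
                      Increasing c × Range c ≐ (Range a ∖ ｛ a k ｝) ∪ ｛ y ｝
exchange-increasing a↑ k y∉a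
  with rest⊆ , ⊆rest ← remove-range (increasing⇒injective a↑) k
  with c , c↑ , c⊆ , ⊆c ← insert-increasing (a↑ ∘ punchIn-mono-< k)
                                            (y∉a ∘ proj₁ ∘ rest⊆) =
  c , c↑ , ([ inj₁ ∘ rest⊆ , inj₂ ]′ ∘ c⊆) , (⊆c ∘ [ inj₁ ∘ ⊆rest , inj₂ ]′)

-- If `t < c i`, the values of `f` at the `toℕ i + 1` indices up to `i` all sit in `c` at positions
-- below `i`, which are one too few. Since `f` need only be injective, it may list its values out of
-- order, as a listing with one entry overwritten does.
increasing-≤ : {c f : Vector ℕ n} → Increasing c → Injective _≡_ _≡_ f → ∀ i {t} →
               (∀ j → j Fin.≤ i → f j ∈ Range c × f j ≤ t) → c i ≤ t
increasing-≤ {n = n} {c = c} {f = f} c↑ f-inj i {t} few with c i ℕ.≤? t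
... | yes ci≤t = ci≤t
... | no  ci≰t =
  let p , q , p<q , same = Fin.pigeonhole (ℕ.n<1+n (toℕ i)) index
  in contradiction (index-injective same) (Fin.<⇒≢ p<q)
  where
  initial : Fin (suc (toℕ i)) → Fin n
  initial l = inject≤ l (Fin.toℕ<n i)

  initial-≤ : ∀ l → initial l Fin.≤ i
  initial-≤ l = subst (_≤ toℕ i) (sym (Fin.toℕ-inject≤ l (Fin.toℕ<n i)))
                                 (ℕ.s≤s⁻¹ (Fin.toℕ<n l))

  found : ∀ l → f (initial l) ∈ Range c × f (initial l) ≤ t
  found l = few (initial l) (initial-≤ l)

  position : Fin (suc (toℕ i)) → Fin _
  position l = proj₁ (proj₁ (found l))

  position-≡ : ∀ l → c (position l) ≡ f (initial l)
  position-≡ l = proj₂ (proj₁ (found l))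

  -- The value of `c` at this position is at most `t`, hence below `c i`, and an increasing `c`
  -- reflects the order.
  position-< : ∀ l → position l Fin.< i
  position-< l = increasing⇒cancel-< c↑
    (ℕ.≤-<-trans (ℕ.≤-reflexive (position-≡ l))
                 (ℕ.≤-<-trans (proj₂ (found l)) (ℕ.≰⇒> ci≰t)))

  index : Fin (suc (toℕ i)) → Fin (toℕ i)
  index l = fromℕ< (position-< l)

  index-injective : Injective _≡_ _≡_ index
  index-injective {p} {q} eq =
    Fin.inject≤-injective (Fin.toℕ<n i) (Fin.toℕ<n i) p q
      (f-inj (trans (sym (position-≡ p)) (trans (cong c positions) (position-≡ q))))
    where
    positions : position p ≡ position q
    positions = Fin.toℕ-injective
      (Fin.fromℕ<-injective _ _ (position-< p) (position-< q) eq)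

module _ (f : Vector ℕ n) (k : Fin n) (y : ℕ) where

  update-view : ∀ i → (i ≡ k × updateAt f k (const y) i ≡ y) ⊎
                      (i ≢ k × updateAt f k (const y) i ≡ f i)
  update-view i with i Fin.≟ k
  ... | yes refl = inj₁ (refl , updateAt-updates k f)
  ... | no  i≢k  = inj₂ (i≢k , updateAt-minimal i k f i≢k)

  -- Only the overwritten entry could clash with another one, and then `y` would be an old value of
  -- `f`.
  update-injective : Injective _≡_ _≡_ f → y ∉ Range f →
                     Injective _≡_ _≡_ (updateAt f k (const y))
  update-injective f-inj y∉f {i} {j} eq with update-view i | update-view j
  ... | inj₁ (refl , _) | inj₁ (refl , _) = refl
  ... | inj₁ (_ , p)    | inj₂ (_ , q)    =
    contradiction (j , trans (sym q) (trans (sym eq) p)) y∉f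
  ... | inj₂ (_ , p)    | inj₁ (_ , q)    =
    contradiction (i , trans (sym p) (trans eq q)) y∉f
  ... | inj₂ (_ , p)    | inj₂ (_ , q)    = f-inj (trans (sym p) (trans eq q))

-- Some entry of `b` lies outside `Range a` since both listings have the same length and `a k` is
-- missing from `b`. Membership in `Range a` is decided by finite search, so a least such index can
-- be found.
least-new : {a b : Vector ℕ (suc n)} → Increasing b → ∀ k → a k ∉ Range b →
            ∃ λ j → b j ∉ Range a × (∀ l → l Fin.< j → b l ∈ Range a)
least-new {n = n} {a} {b} b↑ k ak∉b =
  let j , bj∉a , below = Fin.¬∀⟶∃¬-smallest _ (λ j → b j ∈ Range a)
                           (λ j → Fin.any? λ i → a i ℕ.≟ b j) not-all
  -- The search gives minimality for indices injected from `Fin (toℕ j)`; each `l` below `j` is the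
  -- injection of `fromℕ< l<j`.
  in j , bj∉a , λ l l<j → subst (λ m → b m ∈ Range a)
       (Fin.toℕ-injective (trans (Fin.toℕ-inject (fromℕ< l<j)) (Fin.toℕ-fromℕ< l<j)))
       (below (fromℕ< l<j))
  where
  not-all : ¬ (∀ j → b j ∈ Range a)
  not-all all =
    -- No entry of `b` is found in `a` at position `k`. Punching out `k` therefore leaves `n`
    -- positions for `n + 1` entries, and two entries of `b` coincide.
    let p , q , p<q , same = Fin.pigeonhole (ℕ.n<1+n n) (λ j → punchOut (k≢ j))
        positions = Fin.punchOut-injective (k≢ p) (k≢ q) same
        bp≡bq = trans (sym (proj₂ (all p))) (trans (cong a positions) (proj₂ (all q)))
    in contradiction (increasing⇒injective b↑ bp≡bq) (Fin.<⇒≢ p<q)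
    where
    k≢ : ∀ j → k ≢ proj₁ (all j)
    k≢ j k≡ = ak∉b (j , trans (sym (proj₂ (all j))) (cong a (sym k≡)))

-- The exchange axiom for listings alone; positivity and the sets being listed enter only in
-- `𝓑-exchange`.
exchange-≤ : {s a b : Vector ℕ (suc n)} → Increasing a → Increasing b →
             (∀ i → a i ≤ s i) → (∀ i → b i ≤ s i) → ∀ k → a k ∉ Range b →
             ∃ λ j → b j ∉ Range a ×
             ∃ λ (c : Vector ℕ (suc n)) →
             Increasing c × Range c ≐ (Range a ∖ ｛ a k ｝) ∪ ｛ b j ｝ × (∀ i → c i ≤ s i)
exchange-≤ {s = s} {a} {b} a↑ b↑ a≤s b≤s k ak∉b
  with j , bj∉a , below ← least-new {a = a} b↑ k ak∉b
  with c , c↑ , c≐@(_ , ⊆c) ← exchange-increasing a↑ k bj∉a =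
  j , bj∉a , c , c↑ , c≐ , c≤s
  where
  c≤s : ∀ i → c i ≤ s i
  c≤s i with i Fin.<? j
  ... | yes i<j = increasing-≤ c↑ (increasing⇒injective b↑) i λ l l≤i →
    ⊆c (inj₁ (below l (ℕ.≤-<-trans l≤i i<j) , λ ak≡bl → ak∉b (l , sym ak≡bl))) ,
    ℕ.≤-trans (increasing⇒mono-≤ b↑ l≤i) (b≤s i)
  ... | no  i≮j =
    increasing-≤ c↑ (update-injective a k (b j) (increasing⇒injective a↑) bj∉a) i few
    where
    few : ∀ l → l Fin.≤ i → updateAt a k (const (b j)) l ∈ Range c ×
                            updateAt a k (const (b j)) l ≤ s i
    few l l≤i with update-view a k (b j) l
    ... | inj₁ (_ , eq) rewrite eq =
      ⊆c (inj₂ refl) , ℕ.≤-trans (increasing⇒mono-≤ b↑ (ℕ.≮⇒≥ i≮j)) (b≤s i)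
    ... | inj₂ (l≢k , eq) rewrite eq =
      ⊆c (inj₁ ((l , refl) , l≢k ∘ sym ∘ increasing⇒injective a↑)) ,
      ℕ.≤-trans (increasing⇒mono-≤ a↑ l≤i) (a≤s i)

Lists-respects-≐ : (a Lists_) Respects _≐_
Lists-respects-≐ (A⊆B , B⊆A) a-lists = record
  { positive   = positive a-lists
  ; increasing = increasing a-lists
  ; elements   = λ x → mk⇔ (to (elements a-lists x) ∘ B⊆A) (A⊆B ∘ from (elements a-lists x))
  }

[1⋯]-finite : ∀ m → Finite [1⋯ m ]
-- The list is 1, ..., `m`, with `suc i` standing for index `i`; `i < m` unfolds to `suc i ≤ m`, so
-- one proof serves both ways.
[1⋯]-finite m = applyUpTo suc m , λ x → mk⇔
  (λ { (s≤s _ , x≤m) → ∈-applyUpTo⁺ suc x≤m })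
  (suc-in-range ∘ ∈-applyUpTo⁻ suc)
  where
  suc-in-range : ∀ {x} → (∃ λ i → i < m × x ≡ suc i) → x ∈ [1⋯ m ]
  suc-in-range (i , i<m , refl) = s≤s z≤n , i<m

𝓑-exchange : ∀ {s : Vector ℕ (suc n)} {A B} → A ∈ 𝓑 s → B ∈ 𝓑 s → ∀ {x} → x ∈ A ∖ B →
             ∃ λ y → y ∈ B ∖ A × ((A ∖ ｛ x ｝) ∪ ｛ y ｝) ∈ 𝓑 s
𝓑-exchange {s = s} {A} {B} (a , a-lists , a≤s) (b , b-lists , b≤s) {x} (x∈A , x∉B)
  with k , refl ← to (elements a-lists x) x∈A
  with j , bj∉a , c , c↑ , (c⊆ , ⊆c) , c≤s ←
         exchange-≤ {s = s} (increasing a-lists) (increasing b-lists) a≤s b≤s k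
                            (x∉B ∘ from (elements b-lists _)) =
  b j , (from (elements b-lists _) (j , refl) , bj∉a ∘ to (elements a-lists _)) ,
  c , c-lists , c≤s
  where
  range-positive : ∀ {z} → z ∈ (Range a ∖ ｛ a k ｝) ∪ ｛ b j ｝ → 1 ≤ z
  range-positive (inj₁ ((i , refl) , _)) = positive a-lists i
  range-positive (inj₂ refl)             = positive b-lists j

  c-lists : c Lists ((A ∖ ｛ a k ｝) ∪ ｛ b j ｝)
  c-lists = record
    { positive   = λ i → range-positive (c⊆ (i , refl))
    ; increasing = c↑
    ; elements   = λ z → mk⇔
        ([ (λ (z∈A , x≢z) → ⊆c (inj₁ (to (elements a-lists z) z∈A , x≢z))) , ⊆c ∘ inj₂ ]′)
        ([ (λ (z∈a , x≢z) → inj₁ (from (elements a-lists z) z∈a , x≢z)) , inj₂ ]′ ∘ c⊆)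
    }

theorem4p1 : (n : ℕ) (S : Subset ℕ) (s : Vector ℕ (suc n)) → s Lists S →
    IsMatroidBases [1⋯ last s ] (𝓑 s)
theorem4p1 n S s s-lists = record
  { respects-≐ = λ A≐B (a , a-lists , a≤s) → a , Lists-respects-≐ A≐B a-lists , a≤s
  ; finite     = [1⋯]-finite (last s)
  ; ground     = ground
  ; nonempty   = S , s , s-lists , λ _ → ℕ.≤-refl
  ; exchange   = 𝓑-exchange
  }
  where
  ground : ∀ {A} → A ∈ 𝓑 s → A ⊆ [1⋯ last s ]
  ground (a , a-lists , a≤s) {x} x∈A with i , refl ← to (elements a-lists x) x∈A =
    positive a-lists i ,
    -- `last s` is the value of `s` at the greatest index, hence an upper bound for every `s i`.
    ℕ.≤-trans (a≤s i) (increasing⇒mono-≤ (increasing s-lists) (Fin.≤fromℕ i))
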